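{- Let $G$ be a primitive permutation group on a finite set $\Omega$ of size $n>2$. Then (a) $G$ synchronizes every map $f:\Omega\to\Omega$ of rank $2$; (b) $G$ synchronizes every non-uniform map $f:\Omega\to\Omega$ of rank $3$ or $4$.
   Context: The rank of $f$ is $|\Omega f|$. $G$ synchronizes a non-invertible map $f$ if the semigroup $\langle G,f\rangle$ generated by $G$ and $f$ contains a constant map. The kernel of $f$ is the partition of $\Omega$ into the inverse images of points of the image of $f$; $f$ is uniform if all parts of its kernel have the same size, and non-uniform otherwise. -}

module Defs where

open import Data.Fin.Base using (Fin)
open import Data.Fin.Properties using (inj⇒≟)
open import Data.List.Base using (List; length; map; filter; deduplicate; tabulate)
open import Data.Nat.Base using (ℕ)
open import Data.Product.Base using (∃-syntax; _×_)
open import Function.Base using (_∘_)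
open import Function.Bundles using (_↔_; Inverse)
open import Function.Construct.Composition using (_↔-∘_)
open import Function.Construct.Identity using (↔-id)
open import Function.Construct.Symmetry using (↔-sym)
open import Function.Properties.Inverse using (↔⇒↣)
open import Level using (0ℓ)
open import Relation.Binary.Core using (Rel)
open import Relation.Binary.Definitions using (DecidableEquality)
open import Relation.Binary.PropositionalEquality.Core using (_≡_; _≢_; _≗_)
open import Relation.Binary.Structures using (IsEquivalence)

open Inverse using (to; from)

-- A subgroup of Sym(Ω), where permutations are identified when they agree
-- pointwise.
record PermutationGroup (Ω : Set) : Set₁ where
  field
    Member      : Ω ↔ Ω → Set
    resp-≗      : ∀ {g h} → to g ≗ to h → Member g → Member h
    id-closed   : Member (↔-id Ω)
    ∘-closed    : ∀ {g h} → Member g → Member h → Member (g ↔-∘ h)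
    inv-closed  : ∀ {g} → Member g → Member (↔-sym g)

open PermutationGroup public using (Member)

module _ {Ω : Set} (G : PermutationGroup Ω) where

  Transitive : Set
  Transitive = ∀ x y → ∃[ g ] Member G g × to g x ≡ y

  Preserves : Rel Ω 0ℓ → Set
  Preserves R = ∀ {g} → Member G g → ∀ {x y} → R x y → R (to g x) (to g y)

  -- Partitions are given by their equivalence relations.  The condition
  -- "R is equality or R is universal" is stated as "if R relates two distinct
  -- points then R is universal".  The two agree classically, but since R need
  -- not be decidable, the disjunction would imply excluded middle (take R x y
  -- to be "x ≡ y or P" for a proposition P) and no group would satisfy it.
  record Primitive : Set₁ where
    field
      transitive : Transitive
      only-trivial-partitions :
        ∀ (R : Rel Ω 0ℓ) → IsEquivalence R → Preserves R →
        ∀ {x y} → x ≢ y → R x y → ∀ u v → R u v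

  data Generated (f : Ω → Ω) : (Ω → Ω) → Set where
    group-elt : ∀ {g} → Member G g → Generated f (to g)
    the-map   : Generated f f
    compose   : ∀ {s t} → Generated f s → Generated f t → Generated f (s ∘ t)

  -- When |Ω| > 1 this already forces f to be non-invertible, since otherwise
  -- every element of the semigroup is a permutation.
  Synchronizes : (Ω → Ω) → Set
  Synchronizes f = ∃[ s ] Generated f s × (∃[ c ] (∀ x → s x ≡ c))

module _ {n : ℕ} {Ω : Set} (enum : Ω ↔ Fin n) where

  _≟Ω_ : DecidableEquality Ω
  _≟Ω_ = inj⇒≟ (↔⇒↣ enum)

  points : List Ω
  points = tabulate (from enum)

  rank : (Ω → Ω) → ℕ
  rank f = length (deduplicate _≟Ω_ (map f points))

  preimageSize : (Ω → Ω) → Ω → ℕ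
  preimageSize f y = length (filter (λ x → f x ≟Ω y) points)

  -- The parts of the kernel are the preimages of points f x of the image.
  Uniform : (Ω → Ω) → Set
  Uniform f = ∀ x y → preimageSize f (f x) ≡ preimageSize f (f y)

{-# OPTIONS --safe #-}
module Submission where

-- Let S = ⟨G, f⟩ and let h ∈ S have minimal rank.  Call two points adjacent if no map in S
-- identifies them.  Maps in S preserve adjacency, and the image of any map in S of minimal rank
-- is a clique.  By primitivity, two distinct points cannot be identified by h ∘ g for every
-- g ∈ G, unless h is constant.
--
-- If h has rank 2, it follows that adjacent points form the blocks of a G-invariant partition
-- with blocks of size 2, contradicting n > 2.  If f has minimal rank, then every translate of
-- its image is a section for its kernel, and counting the translates through each point shows
-- that f is uniform.  If rank f = rank h + 1, then the image of f is covered by two cliques,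
-- the images of f ∘ h and of a suitable f ∘ g ∘ h, each missing a single point.  Those two
-- points are then identified by h ∘ k for every k ∈ G.  These cases cover ranks up to 4.

open import Defs
open import Data.Bool.Base using (true; false; if_then_else_)
open import Data.Fin.Base as Fin using (Fin; zero; suc; toℕ; fromℕ<; combine; finToFun; funToFin)
open import Data.Fin.Properties as Fin
  using (any?; pigeonhole; sequence; finToFun-funToFin; funToFin-finToFin)
open import Data.Fin.Patterns using (0F; 1F)
open import Data.List.Base using (List; []; _∷_; length; lookup; map; filter; tabulate; deduplicate)
open import Data.List.Membership.Propositional using (_∈_)
open import Data.List.Membership.Propositional.Properties
  using (∈-map⁺; ∈-map⁻; ∈-filter⁺; ∈-tabulate⁺; ∈-deduplicate⁺; ∈-deduplicate⁻; ∈-lookup)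
open import Data.List.Properties using (length-map; length-tabulate; filter-notAll)
open import Data.List.Relation.Unary.All as All using (All; []; _∷_)
open import Data.List.Relation.Unary.AllPairs using ([]; _∷_)
open import Data.List.Relation.Unary.Any as Any using (here; there; index)
open import Data.List.Relation.Unary.Any.Properties using (lookup-index)
open import Data.List.Relation.Unary.Unique.Propositional using (Unique)
open import Data.List.Relation.Unary.Unique.Propositional.Properties using (tabulate⁺)
import Data.List.Relation.Unary.Unique.DecPropositional.Properties as Unique
open import Data.Nat.Base using (ℕ; zero; suc; _+_; _*_; _^_; _≤_; _<_; _>_; s≤s)
open import Data.Nat.Induction using (Acc; acc; <-wellFounded)
open import Data.Nat.Properties as ℕ
  using ( ≤-refl; ≤-reflexive; ≤-trans; ≤-antisym; ≤-pred; n≤1+n; m≤m+n; _≤?_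
        ; <-irrefl; <-≤-trans; ≤-<-trans; <⇒≤; <⇒≱; ≮⇒≥; ≰⇒>; ≤∧≢⇒<
        ; +-identityʳ; *-zeroʳ; *-cancelʳ-≡; *-commutativeSemigroup; +-*-semiring)
open import Data.Product.Base using (∃-syntax; ∃₂; _×_; _,_; -,_)
open import Data.Sum.Base using (_⊎_; inj₁; inj₂; [_,_]′)
open import Effect.Monad using (RawMonad; mkRawMonad)
open import Function.Base using (_∘_; id; const)
open import Function.Bundles using (_↔_; Inverse; mk↔ₛ′)
open import Function.Construct.Composition using (_↔-∘_)
open import Function.Construct.Identity using (↔-id)
open import Function.Construct.Symmetry using (↔-sym)
open import Level using (0ℓ)
open import Relation.Binary.Core using (Rel)
import Relation.Binary.Definitions as Binary
open import Relation.Binary.Structures using (IsEquivalence)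
open import Relation.Binary.PropositionalEquality
  using (_≡_; _≢_; _≗_; refl; sym; trans; cong; cong₂; subst; ≢-sym; module ≡-Reasoning)
open import Relation.Nullary.Decidable
  using (Dec; yes; no; does; ¬?; map′; _×-dec_; decidable-stable; dec-true; dec-false)
open import Relation.Nullary.Negation.Core using (¬_; contradiction)
open import Algebra.Properties.CommutativeSemigroup *-commutativeSemigroup using (x∙yz≈y∙xz)
open import Algebra.Properties.Semiring.Sum +-*-semiring
  using ( sum; sum-remove; sum-cong-≗; sum-replicate-zero; sum-permute; ∑-comm
        ; *-distribˡ-sum; *-distribʳ-sum)

open Inverse using (to; from; strictlyInverseˡ; strictlyInverseʳ)

private
  variable
    A B : Set

-- Pigeonhole for lists without repetition.

Unique⇒lookup-≢ : {xs : List A} → Unique xs → ∀ {i j} → i Fin.< j → lookup xs i ≢ lookup xs j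
Unique⇒lookup-≢ (x≢ ∷ _) {zero}  {suc j} _   = All.lookup x≢ (∈-lookup j)
Unique⇒lookup-≢ (_ ∷ xs!) {suc i} {suc j} i<j = Unique⇒lookup-≢ xs! (≤-pred i<j)

∈-pigeonhole : (φ : A → B) {xs : List A} {ys : List B} → Unique xs → (∀ {x} → x ∈ xs → φ x ∈ ys) →
               length ys < length xs → ∃₂ λ x y → x ∈ xs × y ∈ xs × x ≢ y × φ x ≡ φ y
∈-pigeonhole φ {xs} {ys} xs! φ∈ ys<xs
  with i , j , i<j , eq ← pigeonhole ys<xs (λ i → index (φ∈ (∈-lookup i)))
  = -, -, ∈-lookup i , ∈-lookup j , Unique⇒lookup-≢ xs! i<j ,
    trans (lookup-index (φ∈ (∈-lookup i)))
      (trans (cong (lookup ys) eq) (sym (lookup-index (φ∈ (∈-lookup j)))))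

Unique-⊆⇒length-≤ : {xs ys : List A} → Unique xs → (∀ {x} → x ∈ xs → x ∈ ys) → length xs ≤ length ys
Unique-⊆⇒length-≤ xs! xs⊆ys = ≮⇒≥ λ ys<xs →
  let _ , _ , _ , _ , x≢y , x≡y = ∈-pigeonhole id xs! xs⊆ys ys<xs in x≢y x≡y

-- Indicators and finite sums.

⟦_⟧ : {P : Set} → Dec P → ℕ
⟦ P? ⟧ = if does P? then 1 else 0

⟦⟧-yes : {P : Set} (P? : Dec P) → P → ⟦ P? ⟧ ≡ 1
⟦⟧-yes P? p = cong (λ b → if b then 1 else 0) (dec-true P? p)

⟦⟧-no : {P : Set} (P? : Dec P) → ¬ P → ⟦ P? ⟧ ≡ 0
⟦⟧-no P? ¬p = cong (λ b → if b then 1 else 0) (dec-false P? ¬p)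

length-filter-tabulate : {P : A → Set} (P? : ∀ x → Dec (P x)) {n : ℕ} (p : Fin n → A) →
                         length (filter P? (tabulate p)) ≡ sum (λ i → ⟦ P? (p i) ⟧)
length-filter-tabulate P? {zero} p = refl
length-filter-tabulate P? {suc n} p with does (P? (p zero))
... | true = cong suc (length-filter-tabulate P? (p ∘ suc))
... | false = length-filter-tabulate P? (p ∘ suc)

sum-single : ∀ {n} (t : Fin n → ℕ) i → (∀ j → j ≢ i → t j ≡ 0) → sum t ≡ t i
sum-single {suc n} t i t≡0 = begin
  sum t                          ≡⟨ sum-remove {i = i} t ⟩
  t i + sum (t ∘ Fin.punchIn i)  ≡⟨ cong (t i +_) (sum-cong-≗ λ j → t≡0 _ (Fin.punchInᵢ≢i i j)) ⟩
  t i + sum {n} (const 0)        ≡⟨ cong (t i +_) (sum-replicate-zero n) ⟩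
  t i + 0                        ≡⟨ +-identityʳ (t i) ⟩
  t i                            ∎
  where open ≡-Reasoning

≤-sum : ∀ {n} (t : Fin n → ℕ) i → t i ≤ sum t
≤-sum {suc n} t i = ≤-trans (m≤m+n (t i) _) (≤-reflexive (sym (sum-remove {i = i} t)))

funToFin-cong : ∀ {m n} {φ ψ : Fin m → Fin n} → φ ≗ ψ → funToFin φ ≡ funToFin ψ
funToFin-cong {zero}  _ = refl
funToFin-cong {suc m} eq = cong₂ combine (eq zero) (funToFin-cong (eq ∘ suc))

-- Membership in G is undecidable, so classical case distinctions are made relative to the goal.
module Continuation (Goal : Set) where

  M : Set → Set
  M X = (X → Goal) → Goal

  monad : RawMonad M
  monad = mkRawMonad M (λ x k → k x) (λ m φ k → m λ x → φ x k)

  excluded-middle : ∀ {X} → M (X ⊎ (X → Goal))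
  excluded-middle k = k (inj₂ (k ∘ inj₁))

-- Images and ranks of self-maps.

module _ {n : ℕ} {Ω : Set} (enum : Ω ↔ Fin n) where

  private
    infix 4 _≟_
    _≟_ = _≟Ω_ enum

    image : (Ω → Ω) → List Ω
    image f = deduplicate _≟_ (map f (points enum))

    image! : ∀ f → Unique (image f)
    image! f = Unique.deduplicate-! _≟_ (map f (points enum))

    ∈-image⁺ : ∀ f x → f x ∈ image f
    ∈-image⁺ f x = ∈-deduplicate⁺ _≟_ (subst (λ y → f y ∈ map f (points enum)) (strictlyInverseʳ enum x)
      (∈-map⁺ f (∈-tabulate⁺ (to enum x))))

    ∈-image⁻ : ∀ f {y} → y ∈ image f → ∃[ x ] f x ≡ y
    ∈-image⁻ f y∈ with x , _ , y≡fx ← ∈-map⁻ f (∈-deduplicate⁻ _≟_ (map f (points enum)) y∈) = x , sym y≡fx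

    ⊆-image : ∀ {ys} f → (∀ x → f x ∈ ys) → ∀ {y} → y ∈ image f → y ∈ ys
    ⊆-image f f∈ y∈ with x , refl ← ∈-image⁻ f y∈ = f∈ x

  any-point? : {P : Ω → Set} → (∀ x → Dec (P x)) → Dec (∃[ x ] P x)
  any-point? {P} P? = map′ (λ (i , p) → -, p)
    (λ (x , p) → to enum x , subst P (sym (strictlyInverseʳ enum x)) p) (any? (P? ∘ from enum))

  Hit Missed : (Ω → Ω) → Ω → Set
  Hit s y = ∃[ x ] s x ≡ y
  Missed s y = ¬ Hit s y

  hit? : ∀ s y → Dec (Hit s y)
  hit? s y = any-point? λ x → s x ≟ y

  rank-pigeonhole : ∀ {s t u} → (∀ x → Hit u (s (t x))) → rank enum u < rank enum t →
                    ∃₂ λ x y → t x ≢ t y × s (t x) ≡ s (t y)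
  rank-pigeonhole {s} {t} {u} st⊆u u<t =
    let x , y , x∈ , y∈ , x≢y , eq = ∈-pigeonhole s {image t} {image u} (image! t) s∈ u<t
        x′ , tx′≡x = ∈-image⁻ t x∈
        y′ , ty′≡y = ∈-image⁻ t y∈
    in x′ , y′ , (λ tx′≡ty′ → x≢y (trans (sym tx′≡x) (trans tx′≡ty′ ty′≡y))) ,
       trans (cong s tx′≡x) (trans eq (sym (cong s ty′≡y)))
    where
    s∈ : ∀ {y} → y ∈ image t → s y ∈ image u
    s∈ y∈ = let x , tx≡y = ∈-image⁻ t y∈ ; z , uz≡ = st⊆u x in
      subst (_∈ image u) (trans uz≡ (cong s tx≡y)) (∈-image⁺ u z)

  rank-mono : ∀ {t u} → (∀ x → Hit u (t x)) → rank enum t ≤ rank enum u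
  rank-mono {t} {u} t⊆u = ≮⇒≥ λ u<t → let _ , _ , ≢ , ≡ = rank-pigeonhole {id} {t} {u} t⊆u u<t in ≢ ≡

  rank-∘ʳ : ∀ s t → rank enum (s ∘ t) ≤ rank enum t
  rank-∘ʳ s t = ≤-trans
    (Unique-⊆⇒length-≤ (image! (s ∘ t)) (⊆-image (s ∘ t) λ x → ∈-map⁺ s (∈-image⁺ t x)))
    (≤-reflexive (length-map s (image t)))

  rank-collapse : ∀ {s t x y} → t x ≢ t y → s (t x) ≡ s (t y) → rank enum (s ∘ t) < rank enum t
  rank-collapse {s} {t} {x} {y} tx≢ty stx≡sty = ≤-<-trans
    (≤-trans (Unique-⊆⇒length-≤ (image! (s ∘ t)) (⊆-image (s ∘ t) st∈))
             (≤-reflexive (length-map s others)))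
    (filter-notAll ≢? (image t) (Any.map (λ { refl ≢ → ≢ refl }) (∈-image⁺ t y)))
    where
    ≢? = λ z → ¬? (z ≟ t y)
    others = filter ≢? (image t)
    st∈ : ∀ z → s (t z) ∈ map s others
    st∈ z with t z ≟ t y
    ... | yes eq = subst (_∈ map s others) (trans stx≡sty (cong s (sym eq)))
                     (∈-map⁺ s (∈-filter⁺ ≢? (∈-image⁺ t x) tx≢ty))
    ... | no tz≢ty = ∈-map⁺ s (∈-filter⁺ ≢? (∈-image⁺ t z) tz≢ty)

  rank-missed : ∀ {t u} → rank enum t < rank enum u → ∃[ x ] Missed t (u x)
  rank-missed {t} {u} t<u = decidable-stable (any-point? λ x → ¬? (hit? t (u x))) λ ∄ →
    <-irrefl refl (<-≤-trans t<u (rank-mono λ x → decidable-stable (hit? t (u x)) λ m → ∄ (x , m)))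

  module _ {t u : Ω → Ω} (t⊆u : ∀ x → Hit u (t x)) where

    private
      ∈-image : ∀ {y} → y ∈ image t → y ∈ image u
      ∈-image = ⊆-image t λ x → let y , eq = t⊆u x in subst (_∈ image u) eq (∈-image⁺ u y)

      missed : ∀ {y z} → Missed t y → z ∈ image t → y ≢ z
      missed m z∈ refl = m (∈-image⁻ t z∈)

    rank-missed-once : ∀ {x} → Missed t (u x) → rank enum t < rank enum u
    rank-missed-once {x} mx = Unique-⊆⇒length-≤ (All.tabulate (missed mx) ∷ image! t)
      λ { (here refl) → ∈-image⁺ u x ; (there y∈) → ∈-image y∈ }

    rank-missed-twice : ∀ {x y} → u x ≢ u y → Missed t (u x) → Missed t (u y) →
                        suc (rank enum t) < rank enum u
    rank-missed-twice {x} {y} x≢y mx my = Unique-⊆⇒length-≤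
      ((x≢y ∷ All.tabulate (missed mx)) ∷ All.tabulate (missed my) ∷ image! t)
      λ { (here refl) → ∈-image⁺ u x
        ; (there (here refl)) → ∈-image⁺ u y
        ; (there (there z∈)) → ∈-image z∈ }

  length≤rank : ∀ {f ys} → Unique ys → All (Hit f) ys → length ys ≤ rank enum f
  length≤rank {f} ys! hits = Unique-⊆⇒length-≤ ys! λ y∈ →
    let x , eq = All.lookup hits y∈ in subst (_∈ image f) eq (∈-image⁺ f x)

  third-point : n > 2 → ∀ p q → ∃[ x ] x ≢ p × x ≢ q
  third-point n>2 p q = decidable-stable (any-point? λ x → ¬? (x ≟ p) ×-dec ¬? (x ≟ q)) λ ∄ →
    <-irrefl refl (<-≤-trans n>2 (≤-trans (≤-reflexive (sym (length-tabulate {n = n} (from enum))))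
      (Unique-⊆⇒length-≤ {xs = points enum} {p ∷ q ∷ []} (tabulate⁺ from-injective) (λ {x} _ → among ∄ x))))
    where
    from-injective : ∀ {i j} → from enum i ≡ from enum j → i ≡ j
    from-injective {i} {j} eq =
      trans (sym (strictlyInverseˡ enum i)) (trans (cong (to enum) eq) (strictlyInverseˡ enum j))
    among : ¬ (∃[ x ] x ≢ p × x ≢ q) → ∀ x → x ∈ p ∷ q ∷ []
    among ∄ x with x ≟ p | x ≟ q
    ... | yes x≡p | _ = here x≡p
    ... | no _ | yes x≡q = there (here x≡q)
    ... | no x≢p | no x≢q = contradiction (x , x≢p , x≢q) ∄

  -- Adjacency and primitivity.

  module _ (G : PermutationGroup Ω) (prim : Primitive G) (f : Ω → Ω) where

    open Primitive prim

    private
      S = Generated G f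
      Goal = Synchronizes G f

    -- Here and in Minimal, negation is taken relative to Goal in place of ⊥.
    Adjacent : Ω → Ω → Set
    Adjacent x y = ∀ {s} → S s → s x ≡ s y → Goal

    Minimal : (Ω → Ω) → Set
    Minimal h = ∀ {s} → S s → rank enum s < rank enum h → Goal

    -- A map identifying `s x` with `s y` would, composed with `s`, have rank below the minimum.
    adjacent-image : ∀ {h s x y} → Minimal h → S s → rank enum s ≤ rank enum h →
                     s x ≢ s y → Adjacent (s x) (s y)
    adjacent-image {s = s} min s∈ s≤h x≢y {t} t∈ eq =
      min (compose t∈ s∈) (<-≤-trans (rank-collapse {t} {s} x≢y eq) s≤h)

    -- The last hypothesis is constancy of `h` with negation relative to `Goal`. Searching for a
    -- value other than `h u` is decidable: one found yields `Goal`, and if there is none, `h`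
    -- itself is the constant map.
    constant⇒sync : ∀ {h} → S h → Ω → (∀ x y → h x ≢ h y → Goal) → Goal
    constant⇒sync {h} h∈ u separated with any-point? (λ x → ¬? (h x ≟ h u))
    ... | yes (x , x≢u) = separated x u x≢u
    ... | no ∄ = h , h∈ , h u , λ x → decidable-stable (h x ≟ h u) λ ≢ → ∄ (x , ≢)

    -- Being separated by no `h ∘ to g` is a G-invariant equivalence. By primitivity it is universal
    -- once it relates two distinct points, and taking `g` to be the identity makes `h` constant.
    merged⇒sync : ∀ {h x y} → S h → x ≢ y →
                  (∀ {g} → Member G g → h (to g x) ≢ h (to g y) → Goal) → Goal
    merged⇒sync {h} {x} {y} h∈ x≢y merged = constant⇒sync h∈ x λ u v →
      only-trivial-partitions R R-equivalence R-preserved x≢y merged u v (PermutationGroup.id-closed G)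
      where
      R : Rel Ω 0ℓ
      R u v = ∀ {g} → Member G g → h (to g u) ≢ h (to g v) → Goal
      R-equivalence : IsEquivalence R
      R-equivalence = record
        { refl = λ _ ≢ → contradiction refl ≢
        ; sym = λ uRv g∈ ≢ → uRv g∈ (≢-sym ≢)
        ; trans = R-trans
        }
        where
        R-trans : Binary.Transitive R
        R-trans {u} {v} {w} uRv vRw {g} g∈ ≢ with h (to g u) ≟ h (to g v)
        ... | yes eq = vRw g∈ λ eq′ → ≢ (trans eq eq′)
        ... | no ≢′ = uRv g∈ ≢′
      R-preserved : Preserves G R
      R-preserved k∈ uRv g∈ = uRv (PermutationGroup.∘-closed G g∈ k∈)

    -- Minimal rank at most two.

    minimal-rank≤2⇒sync : n > 2 → ∀ {h} → S h → Minimal h → rank enum h ≤ 2 → Goal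
    minimal-rank≤2⇒sync n>2 {h} h∈ min h≤2 = constant⇒sync h∈ u λ x y hx≢hy →
      let hx~hy = adjacent-image {s = h} min h∈ ≤-refl hx≢hy
          w , w≢hx , w≢hy = third-point n>2 (h x) (h y)
          -- Universality of `R` joins `h y` to the third point `w` as well, so `h y` has two
          -- distinct neighbours.
          hyRw = only-trivial-partitions R R-equivalence R-preserved hx≢hy (const hx~hy) (h y) w
      in distinct-neighbours hx~hy (hyRw (≢-sym w≢hy)) (≢-sym w≢hx)
      where
      u : Ω
      u = from enum (fromℕ< n>2)
      -- Each `h ∘ to g` separates the ends of both edges but has at most two values, so it must
      -- identify `u` with `w`.
      distinct-neighbours : ∀ {u v w} → Adjacent u v → Adjacent v w → u ≢ w → Goal
      distinct-neighbours {u} {v} {w} u~v v~w u≢w = merged⇒sync h∈ u≢w separated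
        where
        separated : ∀ {g} → Member G g → h (to g u) ≢ h (to g w) → Goal
        separated {g} g∈ u≢w with h (to g u) ≟ h (to g v) | h (to g v) ≟ h (to g w)
        ... | yes u≡v | _ = u~v (compose h∈ (group-elt g∈)) u≡v
        ... | no _ | yes v≡w = v~w (compose h∈ (group-elt g∈)) v≡w
        ... | no u≢v | no v≢w = contradiction
          (length≤rank {h} ((u≢v ∷ u≢w ∷ []) ∷ (v≢w ∷ []) ∷ [] ∷ [])
                           ((-, refl) ∷ (-, refl) ∷ (-, refl) ∷ []))
          (<⇒≱ (s≤s h≤2))
      -- "Equal or adjacent", put as an implication because adjacency is undecidable.
      R : Rel Ω 0ℓ
      R u v = u ≢ v → Adjacent u v
      R-equivalence : IsEquivalence R
      R-equivalence = record
        { refl = contradiction refl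
        ; sym = λ uRv v≢u s∈ eq → uRv (≢-sym v≢u) s∈ (sym eq)
        ; trans = R-trans
        }
        where
        R-trans : Binary.Transitive R
        R-trans {u} {v} {w} uRv vRw u≢w with u ≟ v | v ≟ w
        ... | yes refl | _ = vRw u≢w
        ... | no _ | yes refl = uRv u≢w
        -- A path with distinct ends already gives `Goal`, which is all that adjacency of its ends
        -- asks for.
        ... | no u≢v | no v≢w = λ _ _ → distinct-neighbours (uRv u≢v) (vRw v≢w) u≢w
      R-preserved : Preserves G R
      R-preserved {g} g∈ uRv gu≢gv s∈ eq =
        uRv (λ u≡v → gu≢gv (cong (to g) u≡v)) (compose s∈ (group-elt g∈)) eq

    -- Rank one above the minimum.

    module _ {h : Ω → Ω} (h∈ : S h) (min : Minimal h) (f≡1+h : rank enum f ≡ suc (rank enum h)) where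

      private
        h<f : rank enum h < rank enum f
        h<f = ≤-reflexive (sym f≡1+h)

        -- Two distinct points of the image of f missed by f ∘ s would force rank (f ∘ s) < rank h.
        missed-unique : ∀ s {y z} → S (f ∘ s) → Missed (f ∘ s) (f y) → Missed (f ∘ s) (f z) →
                        (f y ≡ f z → Goal) → Goal
        missed-unique s {y} {z} fs∈ my mz k with f y ≟ f z
        ... | yes eq = k eq
        ... | no y≢z = min {f ∘ s} fs∈ (≤-pred (<-≤-trans
          (rank-missed-twice {f ∘ s} {f} (λ x → s x , refl) {y} {z} y≢z my mz) (≤-reflexive f≡1+h)))

        hit-adjacent : ∀ s {y z} → S (s ∘ h) → y ≢ z → Hit (s ∘ h) y → Hit (s ∘ h) z → Adjacent y z
        hit-adjacent s sh∈ y≢z (_ , refl) (_ , refl) =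
          adjacent-image {h} {s ∘ h} min sh∈ (rank-∘ʳ s h) y≢z

        fh∈ : S (f ∘ h)
        fh∈ = compose the-map h∈

      -- The image of f is a clique missing only the edge {f x, f x′}, so h ∘ k, whose rank is
      -- smaller, must identify f x with f x′.
      minimal-separating⇒sync : ∀ {g k u x x′} → Member G g → Member G k →
        Missed (f ∘ h) (f x) → to g (h u) ≡ x → Missed (f ∘ to g ∘ h) (f x′) →
        h (to k (f x)) ≢ h (to k (f x′)) → Goal
      minimal-separating⇒sync {g} {k} {u} {x} {x′} g∈ k∈ x∉ ghu≡x x′∉ kx≢kx′ =
        let y , z , fy≢fz , eq = rank-pigeonhole {h ∘ to k} {f} {h} (λ y → to k (f y) , refl) h<f
        in separated fy≢fz eq
        where
        fgh∈ : S (f ∘ to g ∘ h)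
        fgh∈ = compose the-map (compose (group-elt g∈) h∈)

        hk∈ : S (h ∘ to k)
        hk∈ = compose h∈ (group-elt k∈)

        -- By uniqueness of the missed point, `f y` is `f x`, which lies in the second clique, the
        -- image of `f ∘ to g ∘ h`. If `f z` lies there too, an edge is collapsed. Otherwise `f z`
        -- is `f x′`, and the collapsed pair is the one assumed to be separated.
        one-missed : ∀ {y z} → f y ≢ f z → h (to k (f y)) ≡ h (to k (f z)) →
                     Missed (f ∘ h) (f y) → Goal
        one-missed {y} {z} fy≢fz eq y∉ = missed-unique h fh∈ x∉ y∉ second
          where
          second : f x ≡ f y → Goal
          second fx≡fy with hit? (f ∘ to g ∘ h) (f z)
          ... | yes z∈ = hit-adjacent (f ∘ to g) fgh∈ fy≢fz (u , trans (cong f ghu≡x) fx≡fy) z∈ hk∈ eq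
          ... | no z∉ = missed-unique (to g ∘ h) fgh∈ x′∉ z∉ λ fx′≡fz → contradiction
            (trans (cong (h ∘ to k) fx≡fy) (trans eq (cong (h ∘ to k) (sym fx′≡fz)))) kx≢kx′

        separated : ∀ {y z} → f y ≢ f z → h (to k (f y)) ≡ h (to k (f z)) → Goal
        separated {y} {z} fy≢fz eq with hit? (f ∘ h) (f y) | hit? (f ∘ h) (f z)
        ... | yes y∈ | yes z∈ = hit-adjacent f fh∈ fy≢fz y∈ z∈ hk∈ eq
        ... | no y∉ | _ = one-missed fy≢fz eq y∉
        ... | _ | no z∉ = one-missed (≢-sym fy≢fz) (sym eq) z∉

      suc-minimal⇒sync : Ω → Goal
      suc-minimal⇒sync u =
        let x , x∉ = rank-missed {f ∘ h} {f} (≤-<-trans (rank-∘ʳ f h) h<f)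
            -- This choice of `g` puts `f x`, missed by the first clique, into the second one. Hence
            -- the point `f x′` missed by the second differs from `f x`.
            g , g∈ , ghu≡x = transitive (h u) x
            x′ , x′∉ = rank-missed {f ∘ to g ∘ h} {f} (≤-<-trans (rank-∘ʳ (f ∘ to g) h) h<f)
        in merged⇒sync h∈ (λ fx≡fx′ → x′∉ (u , trans (cong f ghu≡x) fx≡fx′))
             λ k∈ → minimal-separating⇒sync g∈ k∈ x∉ ghu≡x x′∉

    -- Uniformity of maps of minimal rank, by counting translates of the image.

    module _ (f-min : Minimal f) where

      open Continuation Goal
      open RawMonad monad using (_>>=_; pure; rawApplicative)

      private
        -- Fin (2 ^ n) enumerates the subsets of Ω through their characteristic functions.
        code : Fin (2 ^ n) → Ω → Fin 2
        code c y = finToFun c (to enum y)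

        encode : (Ω → Fin 2) → Fin (2 ^ n)
        encode φ = funToFin (φ ∘ from enum)

        code-encode : ∀ φ → code (encode φ) ≗ φ
        code-encode φ y = trans (finToFun-funToFin (φ ∘ from enum) (to enum y))
                                (cong φ (strictlyInverseʳ enum y))

        code-injective : ∀ {c d} → code c ≗ code d → c ≡ d
        code-injective {c} {d} eq = begin
          c                                ≡⟨ funToFin-finToFin {n} c ⟨
          funToFin (finToFun {2} {n} c)    ≡⟨ funToFin-cong pointwise ⟩
          funToFin (finToFun {2} {n} d)    ≡⟨ funToFin-finToFin {n} d ⟩
          d                                ∎
          where
          open ≡-Reasoning
          pointwise : finToFun {2} {n} c ≗ finToFun d
          pointwise i = subst (λ j → finToFun c j ≡ finToFun d j) (strictlyInverseˡ enum i) (eq (from enum i))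

        shift : Ω ↔ Ω → Fin (2 ^ n) → Fin (2 ^ n)
        shift h c = encode (code c ∘ to h)

        code-shift : ∀ h c y → code (shift h c) y ≡ code c (to h y)
        code-shift h c = code-encode (code c ∘ to h)

        shift-↔ : Ω ↔ Ω → Fin (2 ^ n) ↔ Fin (2 ^ n)
        shift-↔ h = mk↔ₛ′ (shift h) (shift (↔-sym h))
          (λ c → code-injective λ y → trans (code-shift h (shift (↔-sym h) c) y)
            (trans (code-shift (↔-sym h) c (to h y)) (cong (code c) (strictlyInverseʳ h y))))
          (λ c → code-injective λ y → trans (code-shift (↔-sym h) (shift h c) y)
            (trans (code-shift h c (from h y)) (cong (code c) (strictlyInverseˡ h y))))

        χ : Ω → Fin 2
        χ y = if does (hit? f y) then 1F else 0F

        χ-hit : ∀ {y} → Hit f y → χ y ≡ 1F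
        χ-hit {y} hit = cong (λ b → if b then 1F else 0F) (dec-true (hit? f y) hit)

        χ-missed : ∀ {y} → Missed f y → χ y ≡ 0F
        χ-missed {y} missed = cong (λ b → if b then 1F else 0F) (dec-false (hit? f y) missed)

        -- The subset coded by `c` is a translate of the image of `f`, namely by the inverse of `g`.
        InOrbit : Fin (2 ^ n) → Set
        InOrbit c = ∃[ g ] Member G g × (∀ y → code c y ≡ χ (to g y))

        InOrbit-shift⁺ : ∀ {h c} → Member G h → InOrbit c → InOrbit (shift h c)
        InOrbit-shift⁺ {h} {c} h∈ (g , g∈ , eq) =
          g ↔-∘ h , PermutationGroup.∘-closed G g∈ h∈ , λ y → trans (code-shift h c y) (eq (to h y))

        InOrbit-shift⁻ : ∀ {h c} → Member G h → InOrbit (shift h c) → InOrbit c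
        InOrbit-shift⁻ {h} {c} h∈ (g , g∈ , eq) =
          g ↔-∘ ↔-sym h , PermutationGroup.∘-closed G g∈ (PermutationGroup.inv-closed G h∈) , λ y →
            trans (cong (code c) (sym (strictlyInverseˡ h y)))
                  (trans (sym (code-shift h c (from h y))) (eq (from h y)))

        -- Double-negation shift, available because `Ω` is finite.
        sequence-points : {P : Ω → Set} → (∀ x → M (P x)) → M (∀ x → P x)
        sequence-points {P} all k = sequence rawApplicative (all ∘ from enum) λ p →
          k λ x → subst P (strictlyInverseʳ enum x) (p (to enum x))

        κ : Ω → Ω → ℕ
        κ k y = ⟦ f y ≟ k ⟧

        -- A translate of the image of f is a section for the kernel of f.
        section : ∀ {c} → InOrbit c → ∀ x →
                  M (sum (λ i → κ (f x) (from enum i) * toℕ (code c (from enum i))) ≡ 1)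
        section {c} (g , g∈ , eq) x with hit? (f ∘ from g ∘ f) (f x)
        -- Missing `f x` would give `f ∘ from g ∘ f` a rank below that of `f`.
        ... | no missed = λ _ → f-min s∈ (rank-missed-once (λ y → from g (f y) , refl) {x} missed)
          where
          s∈ : S (f ∘ from g ∘ f)
          s∈ = compose the-map (compose (group-elt (PermutationGroup.inv-closed G g∈)) the-map)
        ... | yes (z , fgfz≡fx) = do
            zero-elsewhere ← sequence rawApplicative elsewhere
            pure (trans (sum-single term i zero-elsewhere) at-i)
          where
          s∈ : S (f ∘ from g ∘ f)
          s∈ = compose the-map (compose (group-elt (PermutationGroup.inv-closed G g∈)) the-map)
          term : Fin n → ℕ
          term i = κ (f x) (from enum i) * toℕ (code c (from enum i))
          -- The point where the translate meets the kernel class of `x`.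
          y = from g (f z)
          i = to enum y
          at-i : term i ≡ 1
          at-i rewrite strictlyInverseʳ enum y = cong₂ _*_ (⟦⟧-yes (f y ≟ f x) fgfz≡fx)
            (cong toℕ (trans (eq y) (χ-hit (z , sym (strictlyInverseˡ g (f z))))))
          elsewhere : ∀ j → M (j ≢ i → term j ≡ 0)
          elsewhere j k with f (from enum j) ≟ f x | hit? f (to g (from enum j)) | j Fin.≟ i
          ... | no ≢ | _ | _ = k λ _ →
            cong (_* toℕ (code c (from enum j))) (⟦⟧-no (f (from enum j) ≟ f x) ≢)
          ... | yes _ | no ≢ | _ = k λ _ →
            trans (cong (λ b → κ (f x) (from enum j) * toℕ b) (trans (eq (from enum j)) (χ-missed ≢)))
                  (*-zeroʳ (κ (f x) (from enum j)))
          ... | yes _ | yes _ | yes j≡i = k λ j≢i → contradiction j≡i j≢i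
          -- A second point of the translate in this class would make `f ∘ from g` identify the
          -- distinct image points `f z` and `f z′`, lowering the rank.
          ... | yes fj≡fx | yes (z′ , fz′≡gj) | no j≢i = f-min s∈
            (rank-collapse {f ∘ from g} {f} {z} {z′}
              (λ fz≡fz′ → j≢i (trans (sym (strictlyInverseˡ enum j))
                (cong (to enum) (trans (sym gfz′≡j) (cong (from g) (sym fz≡fz′))))))
              (trans fgfz≡fx (trans (sym fj≡fx) (cong f (sym gfz′≡j)))))
            where
            gfz′≡j : from g (f z′) ≡ from enum j
            gfz′≡j = trans (cong (from g) fz′≡gj) (strictlyInverseʳ g (from enum j))

        module _ (in-orbit? : ∀ c → InOrbit c ⊎ (InOrbit c → Goal)) where

          w : Fin (2 ^ n) → ℕ
          w c = [ const 1 , const 0 ]′ (in-orbit? c)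

          w-shift : ∀ {h} → Member G h → ∀ c → M (w (shift h c) ≡ w c)
          w-shift {h} h∈ c k with in-orbit? (shift h c) | in-orbit? c
          ... | inj₁ _ | inj₁ _ = k refl
          ... | inj₂ _ | inj₂ _ = k refl
          ... | inj₁ hc∈ | inj₂ c∉ = c∉ (InOrbit-shift⁻ h∈ hc∈)
          ... | inj₂ hc∉ | inj₁ c∈ = hc∉ (InOrbit-shift⁺ h∈ c∈)

          U : Fin (2 ^ n) → Ω → ℕ
          U c y = w c * toℕ (code c y)

          -- The number of translates of the image of `f` through `y`. Equal translates share a code
          -- and count once.
          degree : Ω → ℕ
          degree y = sum (λ c → U c y)

          -- The bijection `shift h` permutes the translates and turns those through `to h y` into
          -- those through `y`.
          degree-invariant : ∀ {h} → Member G h → ∀ y → M (degree (to h y) ≡ degree y)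
          degree-invariant {h} h∈ y = do
              w-eq ← sequence rawApplicative (w-shift h∈)
              pure (begin
                sum (λ c → U c (to h y))      ≡⟨ sum-cong-≗ (λ c →
                    cong₂ _*_ (w-eq c) (cong toℕ (code-shift h c y))) ⟨
                sum (λ c → U (shift h c) y)   ≡⟨ sum-permute (λ c → U c y) (shift-↔ h) ⟨
                sum (λ c → U c y)             ∎)
            where open ≡-Reasoning

          degree-constant : ∀ x → M (∀ y → degree y ≡ degree x)
          degree-constant x = sequence-points λ y →
            let h , h∈ , hx≡y = transitive x y in
            subst (λ z → M (degree z ≡ degree x)) hx≡y (degree-invariant h∈ x)

          slice : ∀ x c → M (w c * sum (λ i → κ (f x) (from enum i) * toℕ (code c (from enum i))) ≡ w c)
          slice x c with in-orbit? c
          ... | inj₂ _ = pure refl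
          ... | inj₁ c∈ = do
            eq ← section c∈ x
            pure (cong (1 *_) eq)

          -- Double counting of pairs of a point in the kernel class of `x` and a translate through
          -- it. Every point lies on `degree u` translates by transitivity, and every translate
          -- meets the class exactly once.
          preimageSize*degree : ∀ x u → M (preimageSize enum f (f x) * degree u ≡ sum w)
          preimageSize*degree x u = do
              const-degree ← degree-constant u
              slices ← sequence rawApplicative (slice x)
              pure (begin
                preimageSize enum f (f x) * degree u
                  ≡⟨ cong (_* degree u) (length-filter-tabulate (λ y → f y ≟ f x) (from enum)) ⟩
                sum κᵢ * degree u
                  ≡⟨ *-distribʳ-sum (degree u) κᵢ ⟩
                sum (λ i → κᵢ i * degree u)
                  ≡⟨ sum-cong-≗ (λ i → cong (κᵢ i *_) (sym (const-degree (from enum i)))) ⟩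
                sum (λ i → κᵢ i * degree (from enum i))
                  ≡⟨ sum-cong-≗ (λ i → *-distribˡ-sum (κᵢ i) (λ c → U c (from enum i))) ⟩
                sum (λ i → sum (λ c → κᵢ i * U c (from enum i)))
                  ≡⟨ ∑-comm (λ i c → κᵢ i * U c (from enum i)) ⟩
                sum (λ c → sum (λ i → κᵢ i * (w c * toℕ (code c (from enum i)))))
                  ≡⟨ sum-cong-≗ (λ c → sum-cong-≗ λ i → x∙yz≈y∙xz (κᵢ i) (w c) (toℕ (code c (from enum i)))) ⟩
                sum (λ c → sum (λ i → w c * (κᵢ i * toℕ (code c (from enum i)))))
                  ≡⟨ sum-cong-≗ (λ c → *-distribˡ-sum (w c) (λ i → κᵢ i * toℕ (code c (from enum i)))) ⟨
                sum (λ c → w c * sum (λ i → κᵢ i * toℕ (code c (from enum i))))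
                  ≡⟨ sum-cong-≗ slices ⟩
                sum w ∎)
            where
            open ≡-Reasoning
            κᵢ : Fin n → ℕ
            κᵢ i = κ (f x) (from enum i)

          -- The identity of G puts the image of `f` itself in the orbit.
          orbit-nonempty : M (sum w ≢ 0)
          orbit-nonempty k with in-orbit? (encode χ) in eq
          ... | inj₂ ∉ = ∉ (↔-id Ω , PermutationGroup.id-closed G , code-encode χ)
          ... | inj₁ ∈ = k λ sum≡0 → contradiction
            (≤-trans (≤-reflexive (sym (cong [ const 1 , const 0 ]′ eq)))
              (≤-trans (≤-sum w (encode χ)) (≤-reflexive sum≡0))) λ ()

          preimageSize-constant : ∀ x y → M (preimageSize enum f (f x) ≡ preimageSize enum f (f y))
          preimageSize-constant x y = do
            x-eq ← preimageSize*degree x x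
            -- The base point is again `x`, so both products share the factor `degree x`, which is
            -- nonzero because `sum w` is.
            y-eq ← preimageSize*degree y x
            sum≢0 ← orbit-nonempty
            pure (cancel x-eq y-eq sum≢0)
            where
            cancel : ∀ {a b d t} → a * d ≡ t → b * d ≡ t → t ≢ 0 → a ≡ b
            cancel {a} {b} {zero} ad≡t bd≡t t≢0 = contradiction (trans (sym ad≡t) (*-zeroʳ a)) t≢0
            cancel {a} {b} {suc d} ad≡t bd≡t _ = *-cancelʳ-≡ a b (suc d) (trans ad≡t (sym bd≡t))

      minimal-nonuniform⇒sync : ¬ Uniform enum f → Goal
      minimal-nonuniform⇒sync ¬uniform =
        -- There are finitely many codes, so orbit membership can be decided for all of them at once
        -- relative to `Goal`.
        sequence rawApplicative (λ c → excluded-middle) λ in-orbit? →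
        sequence-points (λ x → sequence-points (preimageSize-constant in-orbit? x)) λ uniform →
        contradiction uniform ¬uniform

    -- Descent to minimal rank and the case distinction.

    descent : (∀ {h} → S h → rank enum h ≤ rank enum f → Minimal h → Goal) → Goal
    descent minimal⇒sync = go the-map ≤-refl (<-wellFounded _)
      where
      go : ∀ {h} → S h → rank enum h ≤ rank enum f → Acc _<_ (rank enum h) → Goal
      -- `Minimal h` asks for `Goal` from any map of smaller rank, which is exactly what the
      -- recursive call delivers; no minimum is ever computed.
      go h∈ h≤f (acc rs) = minimal⇒sync h∈ h≤f λ s∈ s<h → go s∈ (<⇒≤ (<-≤-trans s<h h≤f)) (rs s<h)

    low-rank⇒sync : n > 2 → (rank enum f ≤ 2 ⊎ (rank enum f ≤ 4 × ¬ Uniform enum f)) → Goal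
    low-rank⇒sync n>2 hyp = descent λ {h} h∈ h≤f h-min → cases h h∈ h≤f h-min hyp
      where
      cases : ∀ h → S h → rank enum h ≤ rank enum f → Minimal h →
              (rank enum f ≤ 2 ⊎ (rank enum f ≤ 4 × ¬ Uniform enum f)) → Goal
      cases h h∈ h≤f h-min hyp with rank enum h ≤? 2 | rank enum h ℕ.≟ rank enum f
      ... | yes h≤2 | _ = minimal-rank≤2⇒sync n>2 h∈ h-min h≤2
      ... | no h≰2 | eq? with hyp
      ...   | inj₁ f≤2 = contradiction (≤-trans h≤f f≤2) h≰2
      ...   | inj₂ (f≤4 , ¬uniform) with eq?
      ...     | yes h≡f =
        minimal-nonuniform⇒sync (λ s∈ s<f → h-min s∈ (<-≤-trans s<f (≤-reflexive (sym h≡f)))) ¬uniform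
      -- Here `h` has rank at least 3 and less than that of `f`, which is at most 4, so the ranks
      -- are 3 and 4.
      ...     | no h≢f = suc-minimal⇒sync h∈ h-min
        (≤-antisym (≤-trans f≤4 (s≤s (≰⇒> h≰2))) (≤∧≢⇒< h≤f h≢f)) (from enum (fromℕ< n>2))

theorem4 : (n : ℕ) (Ω : Set) (enum : Ω ↔ Fin n) → n > 2 →
    (G : PermutationGroup Ω) → Primitive G →
    ((f : Ω → Ω) → rank enum f ≡ 2 → Synchronizes G f) ×
    ((f : Ω → Ω) → rank enum f ≡ 3 ⊎ rank enum f ≡ 4 → ¬ Uniform enum f → Synchronizes G f)
theorem4 n Ω enum n>2 G prim =
  (λ f f≡2 → low-rank⇒sync enum G prim f n>2 (inj₁ (≤-reflexive f≡2))) ,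
  (λ f f≡3∨4 ¬uniform → low-rank⇒sync enum G prim f n>2 (inj₂
    ([ (λ f≡3 → ≤-trans (≤-reflexive f≡3) (n≤1+n 3)) , ≤-reflexive ]′ f≡3∨4 , ¬uniform)))
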